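{- For every integer $d \geq 1$, let $b(d)$ be the maximum cardinality of a minimal edge cover of degree $d$ of a complete bipartite graph. Then $$3 \cdot 2^{d-1} - 2 \leq b(d) \leq (d-1)\binom{2d-1}{d} + 1.$$
   Context: For a finite graph $G$, a family $\mathcal{H}$ of subsets of $V(G)$ is an edge cover of $G$ iff every edge of $G$ (viewed as a 2-element vertex set) is included in some member of $\mathcal{H}$; it is a minimal edge cover iff no proper subfamily of $\mathcal{H}$ is an edge cover of $G$. $\mathcal{H}$ has degree $d$ if every vertex of $G$ belongs to at most $d$ members of $\mathcal{H}$. -}

module Defs where

open import Data.Nat using (ℕ; _+_; _≤_)
open import Data.Fin using (Fin; _↑ˡ_; _↑ʳ_)
open import Data.Fin.Subset using (Subset; _∈_; _∉_)
open import Data.Fin.Subset.Properties using (_∈?_)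
open import Data.List using (List; length; filter)
open import Data.List.Relation.Unary.Any using (Any)
open import Data.List.Relation.Unary.Unique.Propositional using (Unique)
open import Data.List.Membership.Propositional as L using ()
open import Data.Product using (_×_; Σ; ∃)
open import Relation.Nullary using (¬_)

-- The complete bipartite graph K_{m,n}: vertex set Fin (m + n), with parts
-- {i ↑ˡ n | i : Fin m} and {m ↑ʳ j | j : Fin n}; its edges are exactly the
-- pairs {i ↑ˡ n , m ↑ʳ j}.

-- A family of subsets of V(K_{m,n}): a duplicate-free list of subsets
-- (Unique), so that length = cardinality of the family.
Family : ℕ → ℕ → Set
Family m n = List (Subset (m + n))

IsFamily : (m n : ℕ) → Family m n → Set
IsFamily m n H = Unique H

EdgeCover : (m n : ℕ) → Family m n → Set
EdgeCover m n H = (i : Fin m) (j : Fin n) →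
  Any (λ S → (i ↑ˡ n) ∈ S × (m ↑ʳ j) ∈ S) H

ProperSubfamily : (m n : ℕ) → Family m n → Family m n → Set
ProperSubfamily m n H' H =
  IsFamily m n H' × (∀ {S} → S L.∈ H' → S L.∈ H) × ∃ (λ S → S L.∈ H × ¬ (S L.∈ H'))

MinimalEdgeCover : (m n : ℕ) → Family m n → Set
MinimalEdgeCover m n H =
  IsFamily m n H × EdgeCover m n H ×
  (∀ H' → ProperSubfamily m n H' H → ¬ EdgeCover m n H')

HasDegree : (m n d : ℕ) → Family m n → Set
HasDegree m n d H = (v : Fin (m + n)) → length (filter (v ∈?_) H) ≤ d

{-# OPTIONS --safe #-}

-- Write s i and t j for the sets of members containing a left vertex i, resp. a right
-- vertex j.  A minimal edge cover of degree d is then a pair of families of sets of size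
-- at most d, any s i meeting any t j, such that every k is critical: s i ∩ t j = {k} for
-- some i and j.
--
-- Lower bound: two disjoint copies of a critical pair and two new points a, b give
-- the sets s¹ + a, s² + b and t¹ + b, t² + a, so that b(d + 1) ≥ 2 b(d) + 2.
--
-- Upper bound: let crit j be the set of the k with s i ∩ t j = {k} for some i.  Choose
-- T₁, …, Tᵣ among the t j irredundantly so that the sets crit Tⱼ cover everything; let pⱼ
-- be a point critical for Tⱼ alone, with Sⱼ ∩ Tⱼ = {pⱼ}.  As pⱼ is not critical for Tₗ, Sⱼ
-- meets Tₗ outside pⱼ, so Bollobás' inequality for the pairs (Sⱼ ∖ Tⱼ , Tⱼ) yields
-- r ≤ C(2d-1, d).  If this is strict, we are done: a fixed s i meets every Tⱼ, whence there
-- are at most d + r (d - 1) points.  If it is an equality, no Tⱼ consists of d critical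
-- points (and then there are at most r (d - 1) points), because otherwise some ordering of
-- the points has, for every j, an element of Tⱼ before an element of Sⱼ ∖ Tⱼ, which makes
-- Bollobás' inequality strict.

module Submission where

open import Defs
open import Data.Nat
  using (ℕ; zero; suc; _+_; _*_; _∸_; _^_; _≤_; _<_; z≤n; s≤s; z<s; _!; NonZero)
open import Data.Nat.Properties
open import Data.Nat.Combinatorics
  using (_C_; nCk+nC[k+1]≡[n+1]C[k+1]; nCk≡n!/k![n-k]!; k![n∸k]!∣n!)
open import Data.Nat.DivMod using (_/_; m/n*n≡m)
open import Data.Nat.Tactic.RingSolver using (solve-∀)
open import Data.Bool as Bool using (Bool; true; false)
open import Data.Fin using (Fin; zero; suc; punchIn; punchOut; _↑ˡ_; _↑ʳ_; splitAt; join)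
open import Data.Fin.Properties as Fin
  using (punchIn-punchOut; punchInᵢ≢i; any?; all?; splitAt-↑ˡ; splitAt-↑ʳ; splitAt⁻¹-↑ˡ; splitAt⁻¹-↑ʳ)
open import Data.Fin.Subset as Subset
  using (Subset; ∣_∣; _─_; _∈_; _∉_; _∪_; _∩_; ⁅_⁆; Nonempty; ⊥)
open import Data.Fin.Subset.Properties
open import Data.List as List using (List; []; _∷_; map; filter; length)
import Data.List.Properties as List
open import Data.List.Membership.Propositional as L using ()
open import Data.List.Membership.Propositional.Properties
  using (∈-lookup; ∈-filter⁺; ∈-filter⁻; ∈-tabulate⁻)
open import Data.List.Relation.Unary.All as All using (All; []; _∷_)
import Data.List.Relation.Unary.All.Properties as All
open import Data.List.Relation.Unary.AllPairs using (AllPairs; []; _∷_)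
import Data.List.Relation.Unary.AllPairs.Properties as AllPairs
open import Data.List.Relation.Unary.Any as Any using (Any)
import Data.List.Relation.Unary.Any.Properties as Any
open import Data.List.Relation.Unary.Unique.Propositional using (Unique)
import Data.List.Relation.Unary.Unique.Propositional.Properties as Unique
open import Data.Product using (_×_; _,_; proj₁; proj₂; ∃; ∃₂; Σ-syntax)
open import Data.Sum using (_⊎_; inj₁; inj₂; [_,_]′)
open import Data.Vec using ([]; _∷_; here; there; tabulate; lookup; _++_)
open import Data.Vec.Properties
  using ([]=⇒lookup; lookup⇒[]=; lookup∘tabulate; ≡-dec; zipWith-++)
open import Data.Vec.Functional using (removeAt)
open import Algebra.Properties.Semiring.Sum +-*-semiring
  using (sum; sum-cong-≗; sum-remove; ∑-distrib-+; *-distribˡ-sum; *-distribʳ-sum)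
open import Function using (_∘_)
open import Relation.Binary.PropositionalEquality
open import Relation.Nullary using (¬_; Dec; yes; no; contradiction; ¬?; does)
open import Relation.Nullary.Decidable using (dec-true; _×-dec_; decidable-stable)

-- Monotonicity of finite sums and binomial coefficients

sum-mono-≤ : ∀ n {f g : Fin n → ℕ} → (∀ i → f i ≤ g i) → sum f ≤ sum g
sum-mono-≤ zero    f≤g = z≤n
sum-mono-≤ (suc n) f≤g = +-mono-≤ (f≤g zero) (sum-mono-≤ n (f≤g ∘ suc))

sum-mono-< : ∀ n {f g : Fin n → ℕ} → (∀ i → f i ≤ g i) → ∀ i → f i < g i → sum f < sum g
sum-mono-< (suc n) f≤g zero    fi<gi = +-mono-<-≤ fi<gi (sum-mono-≤ n (f≤g ∘ suc))
sum-mono-< (suc n) f≤g (suc i) fi<gi = +-mono-≤-< (f≤g zero) (sum-mono-< n (f≤g ∘ suc) i fi<gi)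

sum-const : ∀ n c → sum {n} (λ _ → c) ≡ n * c
sum-const zero    c = refl
sum-const (suc n) c = cong (c +_) (sum-const n c)

C-monoˡ-suc : ∀ n k → n C k ≤ suc n C k
C-monoˡ-suc n zero    = ≤-refl
C-monoˡ-suc n (suc k) = ≤-trans (m≤n+m _ (n C k)) (≤-reflexive (nCk+nC[k+1]≡[n+1]C[k+1] n k))

C-mono-suc : ∀ n k → n C k ≤ suc n C suc k
C-mono-suc n k = ≤-trans (m≤m+n _ (n C suc k)) (≤-reflexive (nCk+nC[k+1]≡[n+1]C[k+1] n k))

-- Raising either argument by one only adds a term in Pascal's rule.
[a+b]Cb-mono : ∀ {a b c d} → a ≤ c → b ≤ d → (a + b) C b ≤ (c + d) C d
[a+b]Cb-mono {c = zero}  {zero}  z≤n z≤n = ≤-refl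
[a+b]Cb-mono {a} {b} {c} {d} a≤c b≤d with m≤n⇒m<n∨m≡n a≤c | m≤n⇒m<n∨m≡n b≤d
... | inj₂ refl | inj₂ refl = ≤-refl
... | inj₁ (s≤s {n = c′} a≤c′) | _ = ≤-trans ([a+b]Cb-mono a≤c′ b≤d) (C-monoˡ-suc (c′ + d) d)
... | inj₂ refl | inj₁ (s≤s {n = d′} b≤d′) = ≤-trans ([a+b]Cb-mono a≤c b≤d′)
  (≤-trans (C-mono-suc (a + d′) d′) (≤-reflexive (cong (_C suc d′) (sym (+-suc a d′)))))

[a+b]Cb*a!*b! : ∀ a b → ((a + b) C b) * (a ! * b !) ≡ (a + b) !
[a+b]Cb*a!*b! a b = begin
  ((a + b) C b) * (a ! * b !)
    ≡⟨ cong (((a + b) C b) *_) (*-comm (a !) (b !)) ⟩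
  ((a + b) C b) * (b ! * a !)
    ≡⟨ cong (λ z → ((a + b) C b) * (b ! * z !)) (m+n∸n≡m a b) ⟨
  ((a + b) C b) * (b ! * (a + b ∸ b) !)
    ≡⟨ cong (_* (b ! * (a + b ∸ b) !)) (nCk≡n!/k![n-k]! b≤a+b) ⟩
  (a + b) ! / (b ! * (a + b ∸ b) !) * (b ! * (a + b ∸ b) !)
    ≡⟨ m/n*n≡m (k![n∸k]!∣n! b≤a+b) ⟩
  (a + b) ! ∎
  where
  open ≡-Reasoning
  instance
    b!*a!≢0 : NonZero (b ! * (a + b ∸ b) !)
    b!*a!≢0 = b !* (a + b ∸ b) !≢0
  b≤a+b : b ≤ a + b
  b≤a+b = m≤n+m b a

-- Bollobás' set-pair inequality

-- A coloring encodes a pair of disjoint sets: the red elements and the blue ones.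
data Color : Set where
  red blue plain : Color

δ : Color → Color → ℕ
δ red   red   = 1
δ blue  blue  = 1
δ plain plain = 1
δ _     _     = 0

#[_] : ∀ {n} → Color → (Fin n → Color) → ℕ
#[ c ] χ = sum (δ c ∘ χ)

sum-by-color : ∀ n (χ : Fin n → Color) (g : Color → ℕ) →
  sum (g ∘ χ) ≡ g red * #[ red ] χ + g blue * #[ blue ] χ + g plain * #[ plain ] χ
sum-by-color zero χ g = sym (cong₂ _+_ (cong₂ _+_ (*-zeroʳ (g red)) (*-zeroʳ (g blue))) (*-zeroʳ (g plain)))
sum-by-color (suc n) χ g = trans (cong (g (χ zero) +_) (sum-by-color n (χ ∘ suc) g))
  (step (χ zero) (g red) (g blue) (g plain) refl refl refl)
  where
  step : ∀ c {r b p} x y z → g red ≡ x → g blue ≡ y → g plain ≡ z →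
    g c + (x * r + y * b + z * p) ≡ x * (δ red c + r) + y * (δ blue c + b) + z * (δ plain c + p)
  step red   x y z refl _ _ = lemma x y z _ _ _
    where
    lemma : ∀ x y z r b p → x + (x * r + y * b + z * p) ≡ x * (1 + r) + y * b + z * p
    lemma = solve-∀
  step blue  x y z _ refl _ = lemma x y z _ _ _
    where
    lemma : ∀ x y z r b p → y + (x * r + y * b + z * p) ≡ x * r + y * (1 + b) + z * p
    lemma = solve-∀
  step plain x y z _ _ refl = lemma x y z _ _ _
    where
    lemma : ∀ x y z r b p → z + (x * r + y * b + z * p) ≡ x * r + y * b + z * (1 + p)
    lemma = solve-∀

alive : Color → ℕ
alive blue = 0
alive _    = 1

-- The weight of χ is the number of permutations of Fin n in which every red element
-- precedes every blue one, computed by recursion on the first element, which must not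
-- be blue as long as there is a red one.
weight : ∀ n → (Fin n → Color) → ℕ
weightWith : ∀ n → (Fin (suc n) → Color) → ℕ → ℕ

weight zero    χ = 1
weight (suc n) χ = weightWith n χ (#[ red ] χ)

-- Without red elements every permutation counts.
weightWith n χ zero    = suc n !
weightWith n χ (suc _) = sum (λ v → alive (χ v) * weight n (removeAt χ v))

weight-step : ∀ {n} (χ : Fin (suc n) → Color) v → χ v ≡ red →
  weight (suc n) χ ≡ sum (λ u → alive (χ u) * weight n (removeAt χ u))
weight-step χ v χv≡red with #[ red ] χ in eq
... | suc _ = refl
... | zero  = contradiction
  (trans (sym eq) (trans (sum-remove {i = v} (δ red ∘ χ))
    (cong (λ c → δ red c + #[ red ] (removeAt χ v)) χv≡red))) λ ()

-- Among all orderings, the fraction a! b! / (a + b)! puts the a red elements before the b blue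
-- ones. The equation is cleared of denominators and proved by summing over the first element.
weight-closed : ∀ n (χ : Fin n → Color) →
  weight n χ * (#[ red ] χ + #[ blue ] χ) ! ≡ n ! * (#[ red ] χ ! * #[ blue ] χ !)
weight-closed zero χ = refl
weight-closed (suc n) χ with #[ red ] χ in eqr
... | zero  = cong (suc n ! *_) (sym (*-identityˡ _))
... | suc a = begin
  sum (λ v → alive (χ v) * weight n (removeAt χ v)) * (suc a + b) !
    ≡⟨ *-distribʳ-sum ((suc a + b) !) (λ v → alive (χ v) * weight n (removeAt χ v)) ⟩
  sum (λ v → alive (χ v) * weight n (removeAt χ v) * (suc a + b) !)
    ≡⟨ sum-cong-≗ (λ v → term v (χ v) refl) ⟩
  sum (λ v → n ! * (a ! * b !) * g (χ v))
    ≡⟨ *-distribˡ-sum (n ! * (a ! * b !)) (g ∘ χ) ⟨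
  n ! * (a ! * b !) * sum (g ∘ χ)
    ≡⟨ cong (n ! * (a ! * b !) *_) sum-g ⟩
  n ! * (a ! * b !) * (suc a * suc n)
    ≡⟨ shuffle (n !) (a !) (b !) (suc a) (suc n) ⟩
  suc n ! * (suc a ! * b !) ∎
  where
  open ≡-Reasoning
  b : ℕ
  b = #[ blue ] χ
  -- The factor that the induction hypothesis leaves beside `n ! * (a ! * b !)`, by the color of the
  -- first element. With r = a + 1 red and p plain elements, these factors add up to (r + b) r + r p
  -- = r (r + b + p).
  g : Color → ℕ
  g red   = suc a + b
  g blue  = 0
  g plain = suc a
  shuffle : ∀ n! a! b! x y → n! * (a! * b!) * (x * y) ≡ y * n! * (x * a! * b!)
  shuffle = solve-∀
  sum-g : sum (g ∘ χ) ≡ suc a * suc n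
  sum-g = begin
    sum (g ∘ χ) ≡⟨ sum-by-color (suc n) χ g ⟩
    (suc a + b) * #[ red ] χ + 0 + suc a * #[ plain ] χ
      ≡⟨ cong (λ r → (suc a + b) * r + 0 + suc a * #[ plain ] χ) eqr ⟩
    (suc a + b) * suc a + 0 + suc a * #[ plain ] χ
      ≡⟨ lemma (suc a) b (#[ plain ] χ) ⟩
    suc a * (1 * suc a + 1 * b + 1 * #[ plain ] χ)
      ≡⟨ cong (λ r → suc a * (1 * r + 1 * b + 1 * #[ plain ] χ)) eqr ⟨
    suc a * (1 * #[ red ] χ + 1 * b + 1 * #[ plain ] χ)
      ≡⟨ cong (suc a *_) (sum-by-color (suc n) χ (λ _ → 1)) ⟨
    suc a * sum {suc n} (λ _ → 1) ≡⟨ cong (suc a *_) (trans (sum-const (suc n) 1) (*-identityʳ (suc n))) ⟩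
    suc a * suc n ∎
    where
    lemma : ∀ a b p → (a + b) * a + 0 + a * p ≡ a * (1 * a + 1 * b + 1 * p)
    lemma = solve-∀
  removed : ∀ v c → #[ c ] χ ≡ δ c (χ v) + #[ c ] (removeAt χ v)
  removed v c = sum-remove {i = v} (δ c ∘ χ)
  term : ∀ v c → χ v ≡ c →
    alive c * weight n (removeAt χ v) * (suc a + b) ! ≡ n ! * (a ! * b !) * g c
  term v blue  χv = sym (*-zeroʳ (n ! * (a ! * b !)))
  term v red   χv = begin
    1 * weight n χ′ * (suc a + b) !
      ≡⟨ lemma₁ (weight n χ′) (suc a + b) ((a + b) !) ⟩
    weight n χ′ * (a + b) ! * (suc a + b)
      ≡⟨ cong (_* (suc a + b))
           (subst₂ (λ r b → weight n χ′ * (r + b) ! ≡ n ! * (r ! * b !)) r′ b′ (weight-closed n χ′)) ⟩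
    n ! * (a ! * b !) * (suc a + b) ∎
    where
    χ′ = removeAt χ v
    lemma₁ : ∀ w x y → 1 * w * (x * y) ≡ w * y * x
    lemma₁ = solve-∀
    r′ : #[ red ] χ′ ≡ a
    r′ = suc-injective (sym (trans (sym eqr) (trans (removed v red)
      (cong (λ c → δ red c + #[ red ] χ′) χv))))
    b′ : #[ blue ] χ′ ≡ b
    b′ = sym (trans (removed v blue) (cong (λ c → δ blue c + #[ blue ] χ′) χv))
  term v plain χv = begin
    1 * weight n χ′ * (suc a + b) !
      ≡⟨ cong (_* (suc a + b) !) (*-identityˡ (weight n χ′)) ⟩
    weight n χ′ * (suc a + b) !
      ≡⟨ subst₂ (λ r b → weight n χ′ * (r + b) ! ≡ n ! * (r ! * b !)) r′ b′ (weight-closed n χ′) ⟩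
    n ! * (suc a * a ! * b !)
      ≡⟨ lemma₂ (n !) (suc a) (a !) (b !) ⟩
    n ! * (a ! * b !) * suc a ∎
    where
    χ′ = removeAt χ v
    lemma₂ : ∀ n! x a! b! → n! * (x * a! * b!) ≡ n! * (a! * b!) * x
    lemma₂ = solve-∀
    r′ : #[ red ] χ′ ≡ suc a
    r′ = sym (trans (sym eqr) (trans (removed v red) (cong (λ c → δ red c + #[ red ] χ′) χv)))
    b′ : #[ blue ] χ′ ≡ b
    b′ = sym (trans (removed v blue) (cong (λ c → δ blue c + #[ blue ] χ′) χv))

weight*C≡n! : ∀ n (χ : Fin n → Color) →
  weight n χ * ((#[ red ] χ + #[ blue ] χ) C #[ blue ] χ) ≡ n !
weight*C≡n! n χ = *-cancelʳ-≡ _ _ (a ! * b !) {{a !* b !≢0}} (begin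
  w * ((a + b) C b) * (a ! * b !)   ≡⟨ *-assoc w _ _ ⟩
  w * (((a + b) C b) * (a ! * b !))   ≡⟨ cong (w *_) ([a+b]Cb*a!*b! a b) ⟩
  w * (a + b) !                     ≡⟨ weight-closed n χ ⟩
  n ! * (a ! * b !)                 ∎)
  where
  open ≡-Reasoning
  a b w : ℕ
  a = #[ red ] χ
  b = #[ blue ] χ
  w = weight n χ

-- No ordering is counted for both colorings: the first witness would have to precede the second for
-- `χ` and to follow it for `ψ`.
Opposed : ∀ {n} → (Fin n → Color) → (Fin n → Color) → Set
Opposed χ ψ = (∃ λ v → χ v ≡ red × ψ v ≡ blue) × (∃ λ v → ψ v ≡ red × χ v ≡ blue)

-- Ties in `ρ` are allowed: any ordering that refines `ρ` puts this blue element before this red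
-- one, so it is not counted for `χ`.
Ranked : ∀ {n} → (Fin n → ℕ) → (Fin n → Color) → Set
Ranked ρ χ = ∃₂ λ u v → χ u ≡ blue × χ v ≡ red × ρ u < ρ v

blue? : (c : Color) → Dec (c ≡ blue)
blue? red   = no λ ()
blue? blue  = yes refl
blue? plain = no λ ()

total : ∀ {n} → List (Fin n → Color) → ℕ
total []      = 0
total (χ ∷ L) = weight _ χ + total L

-- Placing `v` first rules out the colorings with a red element in which `v` is blue; the others go
-- on with the remaining elements.
survivors : ∀ {n} → Fin (suc n) → List (Fin (suc n) → Color) → List (Fin n → Color)
survivors v L = map (λ χ → removeAt χ v) (filter (λ χ → ¬? (blue? (χ v))) L)

HasRed : ∀ {n} → (Fin n → Color) → Set
HasRed χ = ∃ λ v → χ v ≡ red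

-- Count by the first element and exchange the two sums. `HasRed` ensures that each weight is given
-- by the recursive clause.
total-survivors : ∀ {n} (L : List (Fin (suc n) → Color)) → All HasRed L →
  total L ≡ sum (λ v → total (survivors v L))
total-survivors {n} [] [] = sym (trans (sum-const (suc n) 0) (*-zeroʳ (suc n)))
total-survivors {n} (χ ∷ L) ((v , χv) ∷ reds) = begin
  weight (suc n) χ + total L
    ≡⟨ cong₂ _+_ (weight-step χ v χv) (total-survivors L reds) ⟩
  sum (λ u → alive (χ u) * weight n (removeAt χ u)) + sum (λ u → total (survivors u L))
    ≡⟨ ∑-distrib-+ (λ u → alive (χ u) * weight n (removeAt χ u)) (λ u → total (survivors u L)) ⟨
  sum (λ u → alive (χ u) * weight n (removeAt χ u) + total (survivors u L))
    ≡⟨ sum-cong-≗ split ⟩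
  sum (λ u → total (survivors u (χ ∷ L))) ∎
  where
  open ≡-Reasoning
  split : ∀ u → alive (χ u) * weight n (removeAt χ u) + total (survivors u L) ≡
    total (survivors u (χ ∷ L))
  split u with χ u
  ... | red   = cong (_+ total (survivors u L)) (*-identityˡ _)
  ... | plain = cong (_+ total (survivors u L)) (*-identityˡ _)
  ... | blue  = refl

removeAt-punchOut : ∀ {n} {A : Set} (f : Fin (suc n) → A) {v u} (v≢u : v ≢ u) →
  removeAt f v (punchOut v≢u) ≡ f u
removeAt-punchOut f v≢u = cong f (punchIn-punchOut v≢u)

-- Each witness is blue in one of the two colorings, whereas `v` is blue in neither survivor; hence
-- no witness is deleted.
opposed-survivors : ∀ {n} v {L : List (Fin (suc n) → Color)} →
  AllPairs Opposed L → AllPairs Opposed (survivors v L)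
opposed-survivors v [] = []
opposed-survivors {n} v {χ ∷ L} (opp ∷ opps) with blue? (χ v)
... | yes _  = opposed-survivors v opps
... | no  χ≢ = All.map⁺ (survive L opp) ∷ opposed-survivors v opps
  where
  shrink : ∀ {ψ : Fin (suc n) → Color} → ψ v ≢ blue → Opposed χ ψ →
    Opposed (removeAt χ v) (removeAt ψ v)
  shrink {ψ} ψ≢ ((u , χu , ψu) , (w , ψw , χw)) =
    (punchOut v≢u , trans (removeAt-punchOut χ v≢u) χu , trans (removeAt-punchOut ψ v≢u) ψu) ,
    (punchOut v≢w , trans (removeAt-punchOut ψ v≢w) ψw , trans (removeAt-punchOut χ v≢w) χw)
    where
    v≢u : v ≢ u
    v≢u refl = ψ≢ ψu
    v≢w : v ≢ w
    v≢w refl = χ≢ χw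
  survive : ∀ M → All (Opposed χ) M →
    All (λ ψ → Opposed (removeAt χ v) (removeAt ψ v)) (filter (λ ψ → ¬? (blue? (ψ v))) M)
  survive []      []       = []
  survive (ψ ∷ M) (o ∷ os) with blue? (ψ v)
  ... | yes _  = survive M os
  ... | no  ψ≢ = shrink ψ≢ o ∷ survive M os

-- The deleted `v` is not the blue witness, since the coloring survived, nor the red one, which
-- ranks strictly above another element.
ranked-survivors : ∀ {n} v {L : List (Fin (suc n) → Color)} (ρ : Fin (suc n) → ℕ) →
  (∀ u → ρ v ≤ ρ u) →
  All (Ranked ρ) L → All (Ranked (removeAt ρ v)) (survivors v L)
ranked-survivors v ρ min [] = []
ranked-survivors {n} v {χ ∷ L} ρ min ((u , w , χu , χw , ρu<ρw) ∷ rs) with blue? (χ v)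
... | yes _  = ranked-survivors v ρ min rs
... | no  χ≢ =
  (punchOut v≢u , punchOut v≢w , trans (removeAt-punchOut χ v≢u) χu ,
   trans (removeAt-punchOut χ v≢w) χw ,
   subst₂ _<_ (sym (removeAt-punchOut ρ v≢u)) (sym (removeAt-punchOut ρ v≢w)) ρu<ρw)
  ∷ ranked-survivors v ρ min rs
  where
  v≢u : v ≢ u
  v≢u refl = χ≢ χu
  v≢w : v ≢ w
  v≢w refl = <⇒≱ ρu<ρw (min u)

argmin : ∀ {n} (ρ : Fin (suc n) → ℕ) → ∃ λ v → ∀ u → ρ v ≤ ρ u
argmin {zero}  ρ = zero , λ { zero → ≤-refl }
argmin {suc n} ρ with argmin (ρ ∘ suc)
... | v , min with ≤-total (ρ zero) (ρ (suc v))
...   | inj₁ le = zero  , λ { zero → ≤-refl ; (suc u) → ≤-trans le (min u) }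
...   | inj₂ ge = suc v , λ { zero → ge ; (suc u) → min u }

weight≤n! : ∀ n (χ : Fin n → Color) → weight n χ ≤ n !
weight≤n! n χ with (#[ red ] χ + #[ blue ] χ) C #[ blue ] χ | weight*C≡n! n χ
... | zero  | w*0≡n! = contradiction
  (sym (trans (sym (*-zeroʳ (weight n χ))) w*0≡n!)) (m<n⇒n≢0 (1≤n! n))
... | suc k | w*k≡n! = ≤-trans (m≤m*n (weight n χ) (suc k)) (≤-reflexive w*k≡n!)

-- Opposed colorings count disjoint sets of orderings. The induction on the first element wants a
-- red element in each coloring; opposition supplies it once there are two colorings, and a single
-- one is bounded directly.
total≤n! : ∀ n {L : List (Fin n → Color)} → AllPairs Opposed L → total L ≤ n !
total-HasRed≤n! : ∀ n {L : List (Fin (suc n) → Color)} → All HasRed L → AllPairs Opposed L →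
  total L ≤ suc n !

total-HasRed≤n! n {L} reds opp = begin
  total L                           ≡⟨ total-survivors L reds ⟩
  sum (λ v → total (survivors v L)) ≤⟨ sum-mono-≤ (suc n) (λ v → total≤n! n (opposed-survivors v opp)) ⟩
  sum {suc n} (λ v → n !)           ≡⟨ sum-const (suc n) (n !) ⟩
  suc n !                           ∎
  where open ≤-Reasoning

total≤n! zero    []                                = z≤n
total≤n! zero    ([] ∷ [])                         = ≤-refl
total≤n! zero    (((( () , _) , _) ∷ _) ∷ _)
total≤n! (suc n) []                                = z≤n
total≤n! (suc n) {χ ∷ []} ([] ∷ [])                =
  subst (_≤ suc n !) (sym (+-identityʳ (weight (suc n) χ))) (weight≤n! (suc n) χ)
total≤n! (suc n) {χ ∷ ψ ∷ L} opps@((o ∷ os) ∷ _) =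
  total-HasRed≤n! n (red₁ (proj₁ o) ∷ All.map (red₁ ∘ proj₂) (o ∷ os)) opps
  where
  red₁ : ∀ {ξ ζ : Fin (suc n) → Color} → (∃ λ v → ξ v ≡ red × ζ v ≡ blue) → HasRed ξ
  red₁ (v , ξv , _) = v , ξv

-- For `v` of minimal rank, induction shows that some ordering starting with `v` is missed; the
-- other first elements obey the weak bound. At n = 0 nothing is `Ranked`, so the list is empty and
-- 0 < 0!.
total<n! : ∀ n {L : List (Fin n → Color)} (ρ : Fin n → ℕ) →
  AllPairs Opposed L → All (Ranked ρ) L → total L < n !
total<n! zero    {[]} ρ opp [] = z<s
total<n! (suc n) {L} ρ opp ranked with argmin ρ
... | v , min = begin-strict
  total L
    ≡⟨ total-survivors L (All.map (λ (_ , w , _ , χw , _) → w , χw) ranked) ⟩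
  sum (λ v → total (survivors v L))
    <⟨ sum-mono-< (suc n) (λ v → total≤n! n (opposed-survivors v opp)) v at-v ⟩
  sum {suc n} (λ v → n !)
    ≡⟨ sum-const (suc n) (n !) ⟩
  suc n ! ∎
  where
  open ≤-Reasoning
  at-v : total (survivors v L) < n !
  at-v = total<n! n (removeAt ρ v) (opposed-survivors v opp) (ranked-survivors v ρ min ranked)

-- Each coloring takes up n! / C ≥ n! / K orderings.
length*n!≤total*C : ∀ n {K} {L : List (Fin n → Color)} →
  All (λ χ → (#[ red ] χ + #[ blue ] χ) C #[ blue ] χ ≤ K) L → length L * n ! ≤ total L * K
length*n!≤total*C n [] = z≤n
length*n!≤total*C n {K} {χ ∷ L} (χ≤K ∷ L≤K) = begin
  n ! + length L * n !                ≤⟨ +-mono-≤ one (length*n!≤total*C n L≤K) ⟩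
  weight n χ * K + total L * K        ≡⟨ *-distribʳ-+ K (weight n χ) (total L) ⟨
  (weight n χ + total L) * K          ∎
  where
  open ≤-Reasoning
  one : n ! ≤ weight n χ * K
  one = ≤-trans (≤-reflexive (sym (weight*C≡n! n χ))) (*-monoʳ-≤ (weight n χ) χ≤K)

bollobás : ∀ n {K} {L : List (Fin n → Color)} → AllPairs Opposed L →
  All (λ χ → (#[ red ] χ + #[ blue ] χ) C #[ blue ] χ ≤ K) L → length L ≤ K
bollobás n {K} {L} opp L≤K = *-cancelʳ-≤ (length L) K (n !) {{n !≢0}} (begin
  length L * n ! ≤⟨ length*n!≤total*C n L≤K ⟩
  total L * K    ≤⟨ *-monoˡ-≤ K (total≤n! n opp) ⟩
  n ! * K        ≡⟨ *-comm (n !) K ⟩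
  K * n !        ∎)
  where open ≤-Reasoning

-- An ordering ρ as in Ranked violates the condition counted by weight for every χ at once.
bollobás-strict : ∀ n {K} {L : List (Fin n → Color)} (ρ : Fin n → ℕ) →
  AllPairs Opposed L → All (Ranked ρ) L → 0 < K →
  All (λ χ → (#[ red ] χ + #[ blue ] χ) C #[ blue ] χ ≤ K) L → length L < K
bollobás-strict n {suc K} {L} ρ opp ranked _ L≤K = *-cancelʳ-< (n !) (length L) (suc K) (begin-strict
  length L * n !    ≤⟨ length*n!≤total*C n L≤K ⟩
  total L * suc K   <⟨ *-monoˡ-< (suc K) (total<n! n ρ opp ranked) ⟩
  n ! * suc K       ≡⟨ *-comm (n !) (suc K) ⟩
  suc K * n !       ∎)
  where open ≤-Reasoning

-- Colorings from pairs of subsets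

paint : Bool → Bool → Color
paint _     true  = blue
paint true  false = red
paint false false = plain

-- Blue wins on common points, so arbitrary `p` and `q` yield the disjoint pair (`p ─ q` , `q`).
coloring : ∀ {n} → Subset n → Subset n → Fin n → Color
coloring p q v = paint (lookup p v) (lookup q v)

#red-coloring : ∀ {n} (p q : Subset n) → #[ red ] (coloring p q) ≡ ∣ p ─ q ∣
#red-coloring []          []          = refl
#red-coloring (true  ∷ p) (true  ∷ q) = #red-coloring p q
#red-coloring (true  ∷ p) (false ∷ q) = cong suc (#red-coloring p q)
#red-coloring (false ∷ p) (true  ∷ q) = #red-coloring p q
#red-coloring (false ∷ p) (false ∷ q) = #red-coloring p q

#blue-coloring : ∀ {n} (p q : Subset n) → #[ blue ] (coloring p q) ≡ ∣ q ∣
#blue-coloring []          []          = refl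
#blue-coloring (true  ∷ p) (true  ∷ q) = cong suc (#blue-coloring p q)
#blue-coloring (true  ∷ p) (false ∷ q) = #blue-coloring p q
#blue-coloring (false ∷ p) (true  ∷ q) = cong suc (#blue-coloring p q)
#blue-coloring (false ∷ p) (false ∷ q) = #blue-coloring p q

coloring-blue : ∀ {n} (p q : Subset n) {v} → v ∈ q → coloring p q v ≡ blue
coloring-blue p q v∈q rewrite []=⇒lookup v∈q = refl

coloring-red : ∀ {n} (p q : Subset n) {v} → v ∈ p → v ∉ q → coloring p q v ≡ red
coloring-red p q {v} v∈p v∉q rewrite []=⇒lookup v∈p with lookup q v in eq
... | false = refl
... | true  = contradiction (lookup⇒[]= v q eq) v∉q

-- Union bound and irredundant covers

∣p∪q∣≤∣p∣+∣q∣ : ∀ {n} (p q : Subset n) → ∣ p ∪ q ∣ ≤ ∣ p ∣ + ∣ q ∣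
∣p∪q∣≤∣p∣+∣q∣ []          []          = z≤n
∣p∪q∣≤∣p∣+∣q∣ (true  ∷ p) (true  ∷ q) =
  s≤s (≤-trans (∣p∪q∣≤∣p∣+∣q∣ p q) (+-monoʳ-≤ ∣ p ∣ (n≤1+n ∣ q ∣)))
∣p∪q∣≤∣p∣+∣q∣ (true  ∷ p) (false ∷ q) = s≤s (∣p∪q∣≤∣p∣+∣q∣ p q)
∣p∪q∣≤∣p∣+∣q∣ (false ∷ p) (true  ∷ q) =
  ≤-trans (s≤s (∣p∪q∣≤∣p∣+∣q∣ p q)) (≤-reflexive (sym (+-suc ∣ p ∣ ∣ q ∣)))
∣p∪q∣≤∣p∣+∣q∣ (false ∷ p) (false ∷ q) = ∣p∪q∣≤∣p∣+∣q∣ p q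

-- `B` accumulates the sets already absorbed; it starts as some `s i` or as `⊥`.
union-bound : ∀ {n} e r (B : Subset n) (A : Fin r → Subset n) →
  (∀ k → k ∈ B ⊎ ∃ λ j → k ∈ A j) → (∀ j → ∣ A j ∣ ≤ e) → n ≤ ∣ B ∣ + r * e
union-bound {n} e zero B A covers _ =
  ≤-trans (≤-reflexive (sym (∣⊤∣≡n n))) (≤-trans (p⊆q⇒∣p∣≤∣q∣ ⊤⊆B) (m≤m+n ∣ B ∣ 0))
  where
  ⊤⊆B : Subset.⊤ Subset.⊆ B
  ⊤⊆B {k} _ with covers k
  ... | inj₁ k∈B = k∈B
union-bound {n} e (suc r) B A covers small = begin
  n                             ≤⟨ union-bound e r (B ∪ A zero) (A ∘ suc) covers′ (small ∘ suc) ⟩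
  ∣ B ∪ A zero ∣ + r * e        ≤⟨ +-monoˡ-≤ (r * e) (∣p∪q∣≤∣p∣+∣q∣ B (A zero)) ⟩
  ∣ B ∣ + ∣ A zero ∣ + r * e    ≤⟨ +-monoˡ-≤ (r * e) (+-monoʳ-≤ ∣ B ∣ (small zero)) ⟩
  ∣ B ∣ + e + r * e             ≡⟨ +-assoc ∣ B ∣ e (r * e) ⟩
  ∣ B ∣ + (e + r * e)           ∎
  where
  open ≤-Reasoning
  covers′ : ∀ k → k ∈ (B ∪ A zero) ⊎ ∃ λ j → k ∈ A (suc j)
  covers′ k with covers k
  ... | inj₁ k∈B           = inj₁ (x∈p∪q⁺ (inj₁ k∈B))
  ... | inj₂ (zero  , k∈A) = inj₁ (x∈p∪q⁺ (inj₂ k∈A))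
  ... | inj₂ (suc j , k∈A) = inj₂ (j , k∈A)

⟦_⟧ : ∀ {n} {P : Fin n → Set} → (∀ k → Dec (P k)) → Subset n
⟦ P? ⟧ = tabulate (does ∘ P?)

∈⟦⟧⁺ : ∀ {n} {P : Fin n → Set} (P? : ∀ k → Dec (P k)) {k} → P k → k ∈ ⟦ P? ⟧
∈⟦⟧⁺ P? {k} pk = lookup⇒[]= k ⟦ P? ⟧ (trans (lookup∘tabulate (does ∘ P?) k) (dec-true (P? k) pk))

∈⟦⟧⁻ : ∀ {n} {P : Fin n → Set} (P? : ∀ k → Dec (P k)) {k} → k ∈ ⟦ P? ⟧ → P k
∈⟦⟧⁻ P? {k} k∈ with P? k | trans (sym (lookup∘tabulate (does ∘ P?) k)) ([]=⇒lookup k∈)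
... | yes pk | _ = pk

irredundant-subcover : ∀ {N} r (R : Fin r → Fin N → Set) → (∀ j k → Dec (R j k)) →
  (∀ k → ∃ λ j → R j k) →
  Σ[ r′ ∈ ℕ ] Σ[ f ∈ (Fin r′ → Fin r) ]
    (∀ k → ∃ λ j → R (f j) k) × (∀ j → ∃ λ p → R (f j) p × (∀ l → R (f l) p → l ≡ j))
irredundant-subcover zero    R R? covers = zero , (λ j → j) , covers , λ ()
irredundant-subcover (suc r) R R? covers
  with any? (λ j → all? (λ k → any? (λ l → R? (punchIn j l) k)))
... | yes (j , covers′)
  with r′ , f , cov , priv ← irredundant-subcover r (R ∘ punchIn j) (R? ∘ punchIn j) covers′
  = r′ , punchIn j ∘ f , cov , priv
... | no  needed = suc r , (λ j → j) , covers , private-point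
  where
  private-point : ∀ j → ∃ λ p → R j p × (∀ l → R l p → l ≡ j)
  private-point j
    with p , unhit ← Fin.¬∀⟶∃¬ _ _ (λ k → any? (λ l → R? (punchIn j l) k)) (λ h → needed (j , h))
    with l , Rlp ← covers p
    = p , subst (λ l → R l p) (only l Rlp) Rlp , only
    where
    only : ∀ l → R l p → l ≡ j
    only l Rlp with j Fin.≟ l
    ... | yes j≡l = sym j≡l
    ... | no  j≢l = contradiction
      (punchOut j≢l , subst (λ i → R i p) (sym (punchIn-punchOut j≢l)) Rlp) unhit

-- The upper bound

-- The dual of a cover with N members: points stand for members, and vertices become sets of points.
-- `cross` is the covering property and `critical` is minimality.
record CriticalPair (d N m n : ℕ) : Set where
  field
    s        : Fin m → Subset N
    t        : Fin n → Subset N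
    ∣s∣≤d    : ∀ i → ∣ s i ∣ ≤ d
    ∣t∣≤d    : ∀ j → ∣ t j ∣ ≤ d
    cross    : ∀ i j → Nonempty (s i ∩ t j)
    critical : ∀ k → ∃₂ λ i j → s i ∩ t j ≡ ⁅ k ⁆

x∈q⇒x∉p─q : ∀ {n} (p q : Subset n) {x} → x ∈ q → x ∉ p ─ q
x∈q⇒x∉p─q (_ ∷ p) (true  ∷ q) here        ()
x∈q⇒x∉p─q (_ ∷ p) (_     ∷ q) (there x∈q) (there x∈p─q) = x∈q⇒x∉p─q p q x∈q x∈p─q

singleton⊎another : ∀ {N} (q : Subset N) k → Nonempty q → q ≡ ⁅ k ⁆ ⊎ ∃ λ u → u ∈ q × u ≢ k
singleton⊎another q k (v , v∈q) with any? (λ u → u ∈? q ×-dec ¬? (u Fin.≟ k))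
... | yes another = inj₂ another
... | no  none    = inj₁ (⊆-antisym q⊆⁅k⁆ ⁅k⁆⊆q)
  where
  only-k : ∀ {u} → u ∈ q → u ≡ k
  only-k {u} u∈q = decidable-stable (u Fin.≟ k) (λ u≢k → none (u , u∈q , u≢k))
  q⊆⁅k⁆ : q Subset.⊆ ⁅ k ⁆
  q⊆⁅k⁆ u∈q = subst (_∈ ⁅ k ⁆) (sym (only-k u∈q)) (x∈⁅x⁆ k)
  ⁅k⁆⊆q : ⁅ k ⁆ Subset.⊆ q
  ⁅k⁆⊆q u∈ = subst (_∈ q) (trans (only-k v∈q) (sym (x∈⁅y⁆⇒x≡y k u∈))) v∈q

∩-singleton-∈ : ∀ {N} {p q : Subset N} {k} → p ∩ q ≡ ⁅ k ⁆ → k ∈ p × k ∈ q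
∩-singleton-∈ {p = p} {q} {k} eq = x∈p∩q⁻ p q (subst (k ∈_) (sym eq) (x∈⁅x⁆ k))

∩-singleton-only : ∀ {N} {p q : Subset N} {k u} → p ∩ q ≡ ⁅ k ⁆ → u ∈ p → u ∈ q → u ≡ k
∩-singleton-only {k = k} {u} eq u∈p u∈q = x∈⁅y⁆⇒x≡y k (subst (u ∈_) eq (x∈p∩q⁺ (u∈p , u∈q)))

-- Encodes the ordering  outside T₁ , y , x , rest of T₁  for the three questions
-- “is it x?”, “is it in T₁?”, “is it y?”.
rank : {P Q R : Set} → Dec P → Dec Q → Dec R → ℕ
rank (yes _) _       _       = 2
rank (no  _) (no  _) _       = 0
rank (no  _) (yes _) (yes _) = 1
rank (no  _) (yes _) (no  _) = 3

module _ {e N m n} (H : CriticalPair (suc e) N m n) where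
  open CriticalPair H

  Crit : Fin n → Fin N → Set
  Crit j k = ∃ λ i → s i ∩ t j ≡ ⁅ k ⁆

  Crit? : ∀ j k → Dec (Crit j k)
  Crit? j k = any? (λ i → ≡-dec Bool._≟_ (s i ∩ t j) ⁅ k ⁆)

  crit : Fin n → Subset N
  crit j = ⟦ Crit? j ⟧

  Crit⇒∈ : ∀ {j k} → Crit j k → k ∈ t j
  Crit⇒∈ (i , eq) = proj₂ (∩-singleton-∈ eq)

  crit⊆t : ∀ j → crit j Subset.⊆ t j
  crit⊆t j = Crit⇒∈ ∘ ∈⟦⟧⁻ (Crit? j)

  module _ {r} (f : Fin r → Fin n) (covers : ∀ k → ∃ λ j → Crit (f j) k)
           (private-point : ∀ j → ∃ λ p → Crit (f j) p × (∀ l → Crit (f l) p → l ≡ j)) where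

    -- This is C(2d-1, d) for d = e + 1; `S j ─ T j` has at most e points, `T j` at most e + 1.
    K : ℕ
    K = (e + suc e) C suc e

    p : Fin r → Fin N
    p j = proj₁ (private-point j)

    p-crit : ∀ j → Crit (f j) (p j)
    p-crit j = proj₁ (proj₂ (private-point j))

    σ : Fin r → Fin m
    σ j = proj₁ (p-crit j)

    T S : Fin r → Subset N
    T j = t (f j)
    S j = s (σ j)

    S∩T : ∀ j → S j ∩ T j ≡ ⁅ p j ⁆
    S∩T j = proj₂ (p-crit j)

    p-private : ∀ {j l} → Crit (f l) (p j) → l ≡ j
    p-private {j} {l} = proj₂ (proj₂ (private-point j)) l

    χ : Fin r → Fin N → Color
    χ j = coloring (S j) (T j)

    -- If `S j` met `T l` in `p j` alone, `p j` would be critical for `T l`. Any other common point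
    -- is outside `T j`, which meets `S j` only in `p j`.
    meet : ∀ {j l} → j ≢ l → ∃ λ u → u ∈ S j × u ∉ T j × u ∈ T l
    meet {j} {l} j≢l with singleton⊎another (S j ∩ T l) (p j) (cross _ (f l))
    ... | inj₁ single = contradiction (sym (p-private (_ , single))) j≢l
    ... | inj₂ (u , u∈ , u≢p) with u∈S , u∈T ← x∈p∩q⁻ (S j) (T l) u∈ =
      u , u∈S , (λ u∈Tj → u≢p (∩-singleton-only (S∩T j) u∈S u∈Tj)) , u∈T

    L : List (Fin N → Color)
    L = List.tabulate χ

    opposed : AllPairs Opposed L
    opposed = AllPairs.tabulate⁺ (λ j≢l → half j≢l , half (j≢l ∘ sym))
      where
      half : ∀ {j l} → j ≢ l → ∃ λ u → χ j u ≡ red × χ l u ≡ blue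
      half {j} {l} j≢l with u , u∈S , u∉T , u∈Tl ← meet j≢l =
        u , coloring-red (S j) (T j) u∈S u∉T , coloring-blue (S l) (T l) u∈Tl

    small : All (λ ψ → (#[ red ] ψ + #[ blue ] ψ) C #[ blue ] ψ ≤ K) L
    small = All.tabulate⁺ λ j → [a+b]Cb-mono
      (≤-trans (≤-reflexive (#red-coloring (S j) (T j)))
        (≤-pred (≤-trans (p∩q≢∅⇒∣p─q∣<∣p∣ (S j) (T j) (cross _ _)) (∣s∣≤d _))))
      (≤-trans (≤-reflexive (#blue-coloring (S j) (T j))) (∣t∣≤d _))

    r≤K : r ≤ K
    r≤K = subst (_≤ K) (List.length-tabulate χ) (bollobás N opposed small)

    -- `s i` meets `t j`, so at least one of the e + 1 possible points is lost.
    ∣crit─s∣≤e : ∀ i j → ∣ crit j ─ s i ∣ ≤ e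
    ∣crit─s∣≤e i j = ≤-pred (≤-trans (p⊂q⇒∣p∣<∣q∣ ⊂t) (∣t∣≤d j))
      where
      ⊂t : (crit j ─ s i) Subset.⊂ t j
      ⊂t with u , u∈ ← cross i j with u∈s , u∈t ← x∈p∩q⁻ (s i) (t j) u∈ =
        (crit⊆t j ∘ p─q⊆p (crit j) (s i)) , u , u∈t ,
        x∈q⇒x∉p─q (crit j) (s i) u∈s

    -- The set `s i` contributes at most e + 1 points, and each of the r critical sets at most e
    -- points outside it.
    N≤1+[1+r]*e : Fin m → N ≤ 1 + suc r * e
    N≤1+[1+r]*e i = ≤-trans
      (union-bound e r (s i) (λ j → crit (f j) ─ s i) covered (∣crit─s∣≤e i ∘ f))
      (+-monoˡ-≤ (r * e) (∣s∣≤d i))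
      where
      covered : ∀ k → k ∈ s i ⊎ ∃ λ j → k ∈ (crit (f j) ─ s i)
      covered k with k ∈? s i | covers k
      ... | yes k∈s | _ = inj₁ k∈s
      ... | no  k∉s | j , c = inj₂ (j , x∈p∧x∉q⇒x∈p─q (∈⟦⟧⁺ (Crit? (f j)) c) k∉s)

    N≤r*e : (∀ j → ∣ crit (f j) ∣ ≤ e) → N ≤ r * e
    N≤r*e ≤e = subst (λ z → N ≤ z + r * e) (∣⊥∣≡0 N)
      (union-bound e r ⊥ (crit ∘ f)
        (λ k → inj₂ (proj₁ (covers k) , ∈⟦⟧⁺ (Crit? _) (proj₂ (covers k)))) ≤e)

    -- The remaining case: `large` forces every point of `T j₁` to be critical, which allows an
    -- ordering `ρ` that violates all the pairs.
    module _ {j₁ j₂} (j₁≢j₂ : j₁ ≢ j₂) (1≤e : 1 ≤ e) (large : e < ∣ crit (f j₁) ∣) where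

      full : ∀ {z} → z ∈ T j₁ → Crit (f j₁) z
      full {z} z∈T with Crit? (f j₁) z
      ... | yes c = c
      -- Otherwise `crit (f j₁)` is a proper subset of `T j₁` and has at most e points.
      ... | no ¬c = contradiction
        (≤-trans (p⊂q⇒∣p∣<∣q∣ (crit⊆t (f j₁) , z , z∈T , ¬c ∘ ∈⟦⟧⁻ (Crit? (f j₁)))) (∣t∣≤d (f j₁)))
        (<⇒≱ (s≤s large))

      another-in-T₁ : ∀ z → ∃ λ y → y ∈ T j₁ × y ≢ z
      another-in-T₁ z with any? (λ y → y ∈? T j₁ ×-dec ¬? (y Fin.≟ z))
      ... | yes found = found
      ... | no  none  = contradiction
        (≤-trans (p⊆q⇒∣p∣≤∣q∣ crit⊆⁅z⁆) (≤-trans (≤-reflexive (∣⁅x⁆∣≡1 z)) 1≤e)) (<⇒≱ large)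
        where
        crit⊆⁅z⁆ : crit (f j₁) Subset.⊆ ⁅ z ⁆
        crit⊆⁅z⁆ {y} y∈ with y Fin.≟ z
        ... | yes refl = x∈⁅x⁆ z
        ... | no  y≢z  = contradiction (y , crit⊆t (f j₁) y∈ , y≢z) none

      v : Fin r → Fin N
      v i = proj₁ (cross (σ i) (f j₁))

      v∈S : ∀ i → v i ∈ S i
      v∈S i = proj₁ (x∈p∩q⁻ (S i) (T j₁) (proj₂ (cross _ (f j₁))))

      v∈T₁ : ∀ i → v i ∈ T j₁
      v∈T₁ i = proj₂ (x∈p∩q⁻ (S i) (T j₁) (proj₂ (cross _ (f j₁))))

      -- All points of `T j₁` are critical for it, while `p i` is critical for `T i` alone.
      p∉T₁ : ∀ {i} → i ≢ j₁ → p i ∉ T j₁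
      p∉T₁ i≢j₁ p∈T₁ = i≢j₁ (sym (p-private (full p∈T₁)))

      -- `S i` and `T i` share only `p i`, which is outside `T j₁`; but `v i` is inside.
      v∉T : ∀ {i} → i ≢ j₁ → v i ∉ T i
      v∉T {i} i≢j₁ v∈T = p∉T₁ i≢j₁
        (subst (_∈ T j₁) (∩-singleton-only (S∩T i) (v∈S i) v∈T) (v∈T₁ i))

      -- The second index `j₂` serves to show that `S j₁ ─ T j₁` is nonempty.
      x : Fin N
      x = proj₁ (meet j₁≢j₂)

      x∈S₁ : x ∈ S j₁
      x∈S₁ = proj₁ (proj₂ (meet j₁≢j₂))

      x∉T₁ : x ∉ T j₁
      x∉T₁ = proj₁ (proj₂ (proj₂ (meet j₁≢j₂)))

      -- The point x may be the private point p l of some l (of at most one); then v l has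
      -- to come after x in the ordering, so it must not be y.
      y-choice : ∃ λ y → y ∈ T j₁ × (∀ i → p i ≡ x → y ≢ v i)
      y-choice with any? (λ l → p l Fin.≟ x)
      ... | no  none with y , y∈T , _ ← another-in-T₁ x =
        y , y∈T , λ i pi≡x → contradiction (i , pi≡x) none
      ... | yes (l , pl≡x) with y , y∈T , y≢v ← another-in-T₁ (v l) =
        y , y∈T , λ i pi≡x → subst (λ i → y ≢ v i)
          (p-private (subst (Crit (f l)) (trans pl≡x (sym pi≡x)) (p-crit l))) y≢v

      y : Fin N
      y = proj₁ y-choice

      y∈T₁ : y ∈ T j₁
      y∈T₁ = proj₁ (proj₂ y-choice)

      ρ : Fin N → ℕ
      ρ u = rank (u Fin.≟ x) (u ∈? T j₁) (u Fin.≟ y)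

      ρ-x : ρ x ≡ 2
      ρ-x with x Fin.≟ x
      ... | yes _  = refl
      ... | no x≢x = contradiction refl x≢x

      ρ-y : ρ y ≡ 1
      ρ-y with y Fin.≟ x | y ∈? T j₁ | y Fin.≟ y
      ... | yes y≡x | _      | _      = contradiction (subst (_∈ T j₁) y≡x y∈T₁) x∉T₁
      ... | no _    | no y∉T | _      = contradiction y∈T₁ y∉T
      ... | no _    | yes _  | no y≢y = contradiction refl y≢y
      ... | no _    | yes _  | yes _  = refl

      ρ-T₁ : ∀ {u} → u ∈ T j₁ → 1 ≤ ρ u
      ρ-T₁ {u} u∈T with u Fin.≟ x | u ∈? T j₁ | u Fin.≟ y
      ... | yes _ | _      | _     = s≤s z≤n
      ... | no _  | no u∉T | _     = contradiction u∈T u∉T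
      ... | no _  | yes _  | yes _ = s≤s z≤n
      ... | no _  | yes _  | no _  = s≤s z≤n

      ρ-T₁-y : ∀ {u} → u ∈ T j₁ → y ≢ u → ρ u ≡ 3
      ρ-T₁-y {u} u∈T y≢u with u Fin.≟ x | u ∈? T j₁ | u Fin.≟ y
      ... | yes u≡x | _      | _       = contradiction (subst (_∈ T j₁) u≡x u∈T) x∉T₁
      ... | no _    | no u∉T | _       = contradiction u∈T u∉T
      ... | no _    | yes _  | yes u≡y = contradiction (sym u≡y) y≢u
      ... | no _    | yes _  | no _    = refl

      -- For `j₁` itself, `y` precedes `x`. For any other i, `p i` precedes `v i`: it is outside
      -- `T j₁`, so its rank is 0 unless it is `x`, and then `v i` has rank 3.
      ranked : ∀ i → Ranked ρ (χ i)
      ranked i with i Fin.≟ j₁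
      ... | yes refl = y , x , coloring-blue (S i) (T i) y∈T₁ , coloring-red (S i) (T i) x∈S₁ x∉T₁ ,
        subst₂ _<_ (sym ρ-y) (sym ρ-x) ≤-refl
      ... | no i≢j₁ = p i , v i , coloring-blue (S i) (T i) (proj₂ (∩-singleton-∈ (S∩T i))) ,
        coloring-red (S i) (T i) (v∈S i) (v∉T i≢j₁) , ρp<ρv
        where
        ρp<ρv : ρ (p i) < ρ (v i)
        ρp<ρv with p i Fin.≟ x
        ... | yes p≡x = subst (2 <_) (sym (ρ-T₁-y (v∈T₁ i) (proj₂ (proj₂ y-choice) i p≡x))) ≤-refl
        ... | no  p≢x with p i ∈? T j₁
        ...   | yes p∈T₁ = contradiction p∈T₁ (p∉T₁ i≢j₁)
        ...   | no  _    = ρ-T₁ (v∈T₁ i)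

      r<K : r < K
      r<K = subst (_< K) (List.length-tabulate χ)
        (bollobás-strict N ρ opposed (All.tabulate⁺ ranked)
          -- `K` is positive, being at least C(0, 0) = 1.
          ([a+b]Cb-mono {0} {0} {e} {suc e} z≤n z≤n) small)

upper-bound : ∀ {e N m n} → CriticalPair (suc e) N m n → N ≤ e * ((e + suc e) C suc e) + 1
upper-bound {N = zero} H = z≤n
upper-bound {e} {suc N} {n = n} H
  with r , f , covers , private-point ← irredundant-subcover n (Crit H) (Crit? H)
         (λ k → let i , j , eq = CriticalPair.critical H k in j , i , eq)
  with r <? (e + suc e) C suc e
... | yes r<C = ≤-trans (N≤1+[1+r]*e H f covers private-point (proj₁ (CriticalPair.critical H zero)))
  (≤-trans (s≤s (*-monoˡ-≤ e r<C)) (≤-reflexive (trans (+-comm 1 _) (cong (_+ 1) (*-comm _ e)))))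
... | no r≮C with all? (λ j → ∣ crit H (f j) ∣ ≤? e)
...   | yes ≤e = ≤-trans (N≤r*e H f covers private-point ≤e) (≤-trans
        (*-monoˡ-≤ e (r≤K H f covers private-point)) (≤-trans (≤-reflexive (*-comm _ e)) (m≤m+n _ 1)))
...   | no ≰e with j₁ , ≰e₁ ← Fin.¬∀⟶∃¬ r _ (λ j → ∣ crit H (f j) ∣ ≤? e) ≰e = large-e e refl
  where
  -- A case split on e by way of an equation. The ordering argument requires e ≥ 1; for e = 0 the
  -- bound through a fixed `s i` already gives 1.
  large-e : ∀ e′ → e ≡ e′ → suc N ≤ e * ((e + suc e) C suc e) + 1
  large-e zero     refl = ≤-trans (N≤1+[1+r]*e H f covers private-point
    (proj₁ (CriticalPair.critical H zero))) (≤-reflexive (cong suc (*-zeroʳ r)))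
  large-e (suc e′) refl = contradiction (r<K H f covers private-point j₁≢j₂ (s≤s z≤n) (≰⇒> ≰e₁)) r≮C
    where
    -- From C(3, 2) = 3, the value of C(2d-1, d) at d = 2; this leaves room for an index other than
    -- `j₁`.
    3≤r : 3 ≤ r
    3≤r = ≤-trans ([a+b]Cb-mono {1} {2} {suc e′} {suc (suc e′)} (s≤s z≤n) (s≤s (s≤s z≤n))) (≮⇒≥ r≮C)
    second : ∀ {r} → 3 ≤ r → (j : Fin r) → ∃ λ j₂ → j ≢ j₂
    second (s≤s (s≤s _)) j = punchIn j zero , punchInᵢ≢i j zero ∘ sym
    j₁≢j₂ : j₁ ≢ proj₁ (second 3≤r j₁)
    j₁≢j₂ = proj₂ (second 3≤r j₁)

-- Minimal edge covers and critical pairs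

lookup-injective : ∀ {A : Set} {xs : List A} → Unique xs →
  ∀ {k l} → List.lookup xs k ≡ List.lookup xs l → k ≡ l
lookup-injective {xs = x ∷ xs} (x∉ ∷ u) {zero}  {zero}  eq = refl
lookup-injective {xs = x ∷ xs} (x∉ ∷ u) {zero}  {suc l} eq = contradiction eq (All.lookup x∉ (∈-lookup l))
lookup-injective {xs = x ∷ xs} (x∉ ∷ u) {suc k} {zero}  eq = contradiction (sym eq) (All.lookup x∉ (∈-lookup k))
lookup-injective {xs = x ∷ xs} (x∉ ∷ u) {suc k} {suc l} eq = cong suc (lookup-injective u eq)

length-filter-tabulate : ∀ {N M} (f : Fin N → Subset M) v →
  length (filter (v ∈?_) (List.tabulate f)) ≡ ∣ ⟦ (λ k → v ∈? f k) ⟧ ∣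
length-filter-tabulate {zero}  f v = refl
length-filter-tabulate {suc N} f v with does (v ∈? f zero)
... | true  = cong suc (length-filter-tabulate (f ∘ suc) v)
... | false = length-filter-tabulate (f ∘ suc) v

_≟ˢ_ : ∀ {n} (p q : Subset n) → Dec (p ≡ q)
_≟ˢ_ = ≡-dec Bool._≟_

-- Deleting the member `k` uncovers some edge. All members including that edge are then equal to the
-- deleted one, hence have index `k` as the list has no duplicates.
minimal⇒critical : ∀ {d} m n {H} → MinimalEdgeCover m n H → HasDegree m n d H →
  CriticalPair d (length H) m n
minimal⇒critical {d} m n {H} (unique , cover , minimal) degree = record
  { s        = λ i → incident (i ↑ˡ n)
  ; t        = λ j → incident (m ↑ʳ j)
  ; ∣s∣≤d    = λ i → ∣incident∣≤d (i ↑ˡ n)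
  ; ∣t∣≤d    = λ j → ∣incident∣≤d (m ↑ʳ j)
  ; cross    = cross
  ; critical = critical
  }
  where
  member : Fin (length H) → Subset (m + n)
  member = List.lookup H
  incident? : ∀ v k → Dec (v ∈ member k)
  incident? v k = v ∈? member k
  incident : Fin (m + n) → Subset (length H)
  incident v = ⟦ incident? v ⟧
  ∣incident∣≤d : ∀ v → ∣ incident v ∣ ≤ d
  ∣incident∣≤d v = subst (_≤ d) (trans (cong (length ∘ filter (v ∈?_)) (sym (List.tabulate-lookup H)))
    (length-filter-tabulate member v)) (degree v)
  cross : ∀ i j → Nonempty (incident (i ↑ˡ n) ∩ incident (m ↑ʳ j))
  cross i j = Any.index (cover i j) , x∈p∩q⁺
    (∈⟦⟧⁺ (incident? (i ↑ˡ n)) (proj₁ both) , ∈⟦⟧⁺ (incident? (m ↑ʳ j)) (proj₂ both))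
    where both = Any.lookup-index (cover i j)
  critical : ∀ k → ∃₂ λ i j → incident (i ↑ˡ n) ∩ incident (m ↑ʳ j) ≡ ⁅ k ⁆
  critical k = i , j , single
    where
    H′ : Family m n
    H′ = filter (λ S → ¬? (S ≟ˢ member k)) H
    proper : ProperSubfamily m n H′ H
    proper = Unique.filter⁺ _ unique , proj₁ ∘ ∈-filter⁻ (λ S → ¬? (S ≟ˢ member k)) ,
      member k , ∈-lookup k ,
      λ k∈H′ → proj₂ (∈-filter⁻ (λ S → ¬? (S ≟ˢ member k)) {xs = H} k∈H′) refl
    covered? : ∀ i j → Dec (Any (λ S → (i ↑ˡ n) ∈ S × (m ↑ʳ j) ∈ S) H′)
    covered? i j = Any.any? (λ S → (i ↑ˡ n) ∈? S ×-dec (m ↑ʳ j) ∈? S) H′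
    uncovered : ∃₂ λ i j → ¬ Any (λ S → (i ↑ˡ n) ∈ S × (m ↑ʳ j) ∈ S) H′
    -- Minimality is a mere negation; the edge is extracted by a finite decidable search.
    uncovered with i , ¬∀j ← Fin.¬∀⟶∃¬ m _ (λ i → Fin.all? (covered? i)) (minimal H′ proper)
              with j , ¬c ← Fin.¬∀⟶∃¬ n _ (covered? i) ¬∀j = i , j , ¬c
    i = proj₁ uncovered
    j = proj₁ (proj₂ uncovered)
    only-k : ∀ {l} → l ∈ incident (i ↑ˡ n) ∩ incident (m ↑ʳ j) → l ≡ k
    only-k {l} l∈ with member l ≟ˢ member k
    ... | yes eq = lookup-injective unique eq
    ... | no  ≢k with l∈s , l∈t ← x∈p∩q⁻ _ _ l∈ = contradiction
      (L.lose (∈-filter⁺ (λ S → ¬? (S ≟ˢ member k)) (∈-lookup {xs = H} l) ≢k)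
        (∈⟦⟧⁻ (incident? (i ↑ˡ n)) l∈s , ∈⟦⟧⁻ (incident? (m ↑ʳ j)) l∈t))
      (proj₂ (proj₂ uncovered))
    single : incident (i ↑ˡ n) ∩ incident (m ↑ʳ j) ≡ ⁅ k ⁆
    single with singleton⊎another _ k (cross i j)
    ... | inj₁ eq = eq
    ... | inj₂ (_ , u∈ , u≢k) = contradiction (only-k u∈) u≢k

critical⇒minimal : ∀ {d N m n} → CriticalPair d N m n →
  Σ[ H ∈ Family m n ] (MinimalEdgeCover m n H × HasDegree m n d H × length H ≡ N)
critical⇒minimal {d} {N} {m} {n} P =
  List.tabulate member , (Unique.tabulate⁺ member-injective , cover , minimal) , degree ,
  List.length-tabulate member
  where
  open CriticalPair P
  incidence : Fin (m + n) → Subset N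
  incidence = [ s , t ]′ ∘ splitAt m
  incidence-↑ˡ : ∀ i → incidence (i ↑ˡ n) ≡ s i
  incidence-↑ˡ i = cong [ s , t ]′ (splitAt-↑ˡ m i n)
  incidence-↑ʳ : ∀ j → incidence (m ↑ʳ j) ≡ t j
  incidence-↑ʳ j = cong [ s , t ]′ (splitAt-↑ʳ m n j)
  ∣incidence∣≤d : ∀ v → ∣ incidence v ∣ ≤ d
  ∣incidence∣≤d v with splitAt m v
  ... | inj₁ i = ∣s∣≤d i
  ... | inj₂ j = ∣t∣≤d j
  member : Fin N → Subset (m + n)
  member k = ⟦ (λ v → k ∈? incidence v) ⟧
  member⁺ : ∀ {k v p} → incidence v ≡ p → k ∈ p → v ∈ member k
  member⁺ {k} refl = ∈⟦⟧⁺ (λ v → k ∈? incidence v)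
  member⁻ : ∀ {k v p} → incidence v ≡ p → v ∈ member k → k ∈ p
  member⁻ {k} refl = ∈⟦⟧⁻ (λ v → k ∈? incidence v)
  cover : EdgeCover m n (List.tabulate member)
  cover i j with k , k∈ ← cross i j with k∈s , k∈t ← x∈p∩q⁻ (s i) (t j) k∈ =
    Any.tabulate⁺ k (member⁺ (incidence-↑ˡ i) k∈s , member⁺ (incidence-↑ʳ j) k∈t)
  -- If the members agree, the edge critical for `k` is also included in member `l`, so `l` is `k`.
  member-injective : ∀ {k l} → member k ≡ member l → k ≡ l
  member-injective {k} {l} eq with i , j , eqk ← critical k with k∈s , k∈t ← ∩-singleton-∈ eqk =
    sym (∩-singleton-only eqk
      (member⁻ (incidence-↑ˡ i) (subst (i ↑ˡ n ∈_) eq (member⁺ (incidence-↑ˡ i) k∈s)))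
      (member⁻ (incidence-↑ʳ j) (subst (m ↑ʳ j ∈_) eq (member⁺ (incidence-↑ʳ j) k∈t))))
  minimal : ∀ H′ → ProperSubfamily m n H′ (List.tabulate member) → ¬ EdgeCover m n H′
  minimal H′ (_ , H′⊆H , S , S∈H , S∉H′) cover′
    with k , refl ← ∈-tabulate⁻ S∈H
    -- The edge critical for the missing member `k` can be covered only by `k`, which therefore is
    -- not missing.
    with i , j , eqk ← critical k
    with S′ , S′∈H′ , i∈S′ , j∈S′ ← L.find (cover′ i j)
    with l , refl ← ∈-tabulate⁻ (H′⊆H S′∈H′)
    with refl ← ∩-singleton-only {u = l} eqk
      (member⁻ (incidence-↑ˡ i) i∈S′) (member⁻ (incidence-↑ʳ j) j∈S′)
    = S∉H′ S′∈H′
  degree : HasDegree m n d (List.tabulate member)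
  degree v = begin
    length (filter (v ∈?_) (List.tabulate member)) ≡⟨ length-filter-tabulate member v ⟩
    ∣ ⟦ (λ k → v ∈? member k) ⟧ ∣                  ≤⟨ p⊆q⇒∣p∣≤∣q∣ (member⁻ refl ∘ ∈⟦⟧⁻ (λ k → v ∈? member k)) ⟩
    ∣ incidence v ∣                                ≤⟨ ∣incidence∣≤d v ⟩
    d ∎
    where open ≤-Reasoning

-- The lower bound

∣p++⊥∣≡∣p∣ : ∀ {m} (p : Subset m) n → ∣ p ++ ⊥ {n} ∣ ≡ ∣ p ∣
∣p++⊥∣≡∣p∣ []          n = ∣⊥∣≡0 n
∣p++⊥∣≡∣p∣ (true  ∷ p) n = cong suc (∣p++⊥∣≡∣p∣ p n)
∣p++⊥∣≡∣p∣ (false ∷ p) n = ∣p++⊥∣≡∣p∣ p n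

∣⊥++p∣≡∣p∣ : ∀ m {n} (p : Subset n) → ∣ ⊥ {m} ++ p ∣ ≡ ∣ p ∣
∣⊥++p∣≡∣p∣ zero    p = refl
∣⊥++p∣≡∣p∣ (suc m) p = ∣⊥++p∣≡∣p∣ m p

⊥++⊥≡⊥ : ∀ m n → ⊥ {m} ++ ⊥ {n} ≡ ⊥
⊥++⊥≡⊥ zero    n = refl
⊥++⊥≡⊥ (suc m) n = cong (false ∷_) (⊥++⊥≡⊥ m n)

⁅i⁆++⊥≡⁅i↑ˡ⁆ : ∀ {m} (i : Fin m) n → ⁅ i ⁆ ++ ⊥ {n} ≡ ⁅ i ↑ˡ n ⁆
⁅i⁆++⊥≡⁅i↑ˡ⁆ {suc m} zero    n = cong (true ∷_) (⊥++⊥≡⊥ m n)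
⁅i⁆++⊥≡⁅i↑ˡ⁆ {suc m} (suc i) n = cong (false ∷_) (⁅i⁆++⊥≡⁅i↑ˡ⁆ i n)

⊥++⁅i⁆≡⁅↑ʳi⁆ : ∀ m {n} (i : Fin n) → ⊥ {m} ++ ⁅ i ⁆ ≡ ⁅ m ↑ʳ i ⁆
⊥++⁅i⁆≡⁅↑ʳi⁆ zero    i = refl
⊥++⁅i⁆≡⁅↑ʳi⁆ (suc m) i = cong (false ∷_) (⊥++⁅i⁆≡⁅↑ʳi⁆ m i)

-- Points 0 and 1 are the new a and b. Within a copy they lie on opposite sides and leave
-- intersections unchanged; across copies the old parts are disjoint, so that exactly a or exactly b
-- is shared.
double : ∀ {d N m n} → Fin N → CriticalPair d N m n →
  CriticalPair (suc d) (2 + (N + N)) (m + m) (n + n)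
double {d} {N} {m} {n} k₀ P = record
  { s        = s′ ∘ splitAt m
  ; t        = t′ ∘ splitAt n
  ; ∣s∣≤d    = ∣s′∣≤d ∘ splitAt m
  ; ∣t∣≤d    = ∣t′∣≤d ∘ splitAt n
  ; cross    = λ i j → cross′ (splitAt m i) (splitAt n j)
  ; critical = critical′
  }
  where
  open CriticalPair P
  s′ : Fin m ⊎ Fin m → Subset (2 + (N + N))
  s′ (inj₁ i) = true  ∷ false ∷ s i ++ ⊥
  s′ (inj₂ i) = false ∷ true  ∷ ⊥ ++ s i
  t′ : Fin n ⊎ Fin n → Subset (2 + (N + N))
  t′ (inj₁ j) = false ∷ true  ∷ t j ++ ⊥
  t′ (inj₂ j) = true  ∷ false ∷ ⊥ ++ t j
  ∣s′∣≤d : ∀ i → ∣ s′ i ∣ ≤ suc d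
  ∣s′∣≤d (inj₁ i) = s≤s (subst (_≤ d) (sym (∣p++⊥∣≡∣p∣ (s i) N)) (∣s∣≤d i))
  ∣s′∣≤d (inj₂ i) = s≤s (subst (_≤ d) (sym (∣⊥++p∣≡∣p∣ N (s i))) (∣s∣≤d i))
  ∣t′∣≤d : ∀ j → ∣ t′ j ∣ ≤ suc d
  ∣t′∣≤d (inj₁ j) = s≤s (subst (_≤ d) (sym (∣p++⊥∣≡∣p∣ (t j) N)) (∣t∣≤d j))
  ∣t′∣≤d (inj₂ j) = s≤s (subst (_≤ d) (sym (∣⊥++p∣≡∣p∣ N (t j))) (∣t∣≤d j))
  ∩₁₁ : ∀ i j → s′ (inj₁ i) ∩ t′ (inj₁ j) ≡ false ∷ false ∷ (s i ∩ t j) ++ ⊥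
  ∩₁₁ i j = cong (λ q → false ∷ false ∷ q)
    (trans (zipWith-++ _ (s i) ⊥ (t j) ⊥) (cong ((s i ∩ t j) ++_) (∩-idem _)))
  ∩₂₂ : ∀ i j → s′ (inj₂ i) ∩ t′ (inj₂ j) ≡ false ∷ false ∷ ⊥ ++ (s i ∩ t j)
  ∩₂₂ i j = cong (λ q → false ∷ false ∷ q)
    (trans (zipWith-++ _ ⊥ (s i) ⊥ (t j)) (cong (_++ (s i ∩ t j)) (∩-idem _)))
  ∩₁₂ : ∀ i j → s′ (inj₁ i) ∩ t′ (inj₂ j) ≡ ⁅ zero ⁆
  ∩₁₂ i j = cong (λ q → true ∷ false ∷ q)
    (trans (zipWith-++ _ (s i) ⊥ ⊥ (t j)) (trans (cong₂ _++_ (∩-zeroʳ (s i)) (∩-zeroˡ (t j))) (⊥++⊥≡⊥ N N)))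
  ∩₂₁ : ∀ i j → s′ (inj₂ i) ∩ t′ (inj₁ j) ≡ ⁅ suc zero ⁆
  ∩₂₁ i j = cong (λ q → false ∷ true ∷ q)
    (trans (zipWith-++ _ ⊥ (s i) (t j) ⊥) (trans (cong₂ _++_ (∩-zeroˡ (t j)) (∩-zeroʳ (s i))) (⊥++⊥≡⊥ N N)))
  cross′ : ∀ i j → Nonempty (s′ i ∩ t′ j)
  cross′ (inj₁ i) (inj₁ j) with k , k∈ ← cross i j =
    suc (suc (k ↑ˡ N)) , subst (suc (suc (k ↑ˡ N)) ∈_) (sym (∩₁₁ i j)) (there (there (∈-++ˡ k∈)))
    where
    ∈-++ˡ : ∀ {M} {p : Subset M} {k} → k ∈ p → k ↑ˡ N ∈ p ++ ⊥ {N}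
    ∈-++ˡ here       = here
    ∈-++ˡ (there k∈) = there (∈-++ˡ k∈)
  cross′ (inj₂ i) (inj₂ j) with k , k∈ ← cross i j =
    suc (suc (N ↑ʳ k)) , subst (suc (suc (N ↑ʳ k)) ∈_) (sym (∩₂₂ i j)) (there (there (∈-++ʳ N k∈)))
    where
    ∈-++ʳ : ∀ M {p : Subset N} {k} → k ∈ p → M ↑ʳ k ∈ ⊥ {M} ++ p
    ∈-++ʳ zero    k∈ = k∈
    ∈-++ʳ (suc M) k∈ = there (∈-++ʳ M k∈)
  cross′ (inj₁ i) (inj₂ j) = zero , here
  cross′ (inj₂ i) (inj₁ j) = suc zero , there here
  glue : ∀ i j k → s′ i ∩ t′ j ≡ ⁅ k ⁆ → ∃₂ λ i j → s′ (splitAt m i) ∩ t′ (splitAt n j) ≡ ⁅ k ⁆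
  glue i j k eq = join m m i , join n n j , subst₂ (λ i j → s′ i ∩ t′ j ≡ ⁅ k ⁆)
    (sym (Fin.splitAt-join m m i)) (sym (Fin.splitAt-join n n j)) eq
  critical′ : ∀ k → ∃₂ λ i j → s′ (splitAt m i) ∩ t′ (splitAt n j) ≡ ⁅ k ⁆
  -- `k₀` merely provides a left and a right index to pair across the copies.
  critical′ zero       with i , j , _ ← critical k₀ = glue (inj₁ i) (inj₂ j) zero (∩₁₂ i j)
  critical′ (suc zero) with i , j , _ ← critical k₀ = glue (inj₂ i) (inj₁ j) (suc zero) (∩₂₁ i j)
  critical′ (suc (suc k)) with splitAt N k in eqk
  ... | inj₁ l with i , j , eq ← critical l = glue (inj₁ i) (inj₁ j) (suc (suc k))
    (trans (∩₁₁ i j) (cong (λ q → false ∷ false ∷ q)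
      (trans (cong (_++ ⊥) eq) (trans (⁅i⁆++⊥≡⁅i↑ˡ⁆ l N) (cong ⁅_⁆ (splitAt⁻¹-↑ˡ eqk))))))
  ... | inj₂ l with i , j , eq ← critical l = glue (inj₂ i) (inj₂ j) (suc (suc k))
    (trans (∩₂₂ i j) (cong (λ q → false ∷ false ∷ q)
      (trans (cong (⊥ ++_) eq) (trans (⊥++⁅i⁆≡⁅↑ʳi⁆ N l) (cong ⁅_⁆ (splitAt⁻¹-↑ʳ eqk))))))

-- Adding 2 turns N ↦ 2N + 2 into plain doubling, starting from 1 + 2 = 3. The form `suc N` supplies
-- the point that `double` asks for.
lower-bound : ∀ e → ∃₂ λ N m → CriticalPair (suc e) (suc N) m m × suc N + 2 ≡ 3 * 2 ^ e
lower-bound zero = 0 , 1 , trivial , refl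
  where
  trivial : CriticalPair 1 1 1 1
  trivial = record
    { s = λ _ → ⁅ zero ⁆ ; t = λ _ → ⁅ zero ⁆ ; ∣s∣≤d = λ _ → ≤-refl ; ∣t∣≤d = λ _ → ≤-refl
    ; cross = λ _ _ → zero , here ; critical = λ { zero → zero , zero , refl } }
lower-bound (suc e) with N , m , P , eq ← lower-bound e =
  suc (suc N + suc N) , m + m , double zero P , (begin
    2 + (suc N + suc N) + 2   ≡⟨ lemma₁ N ⟩
    2 * (suc N + 2)           ≡⟨ cong (2 *_) eq ⟩
    2 * (3 * 2 ^ e)           ≡⟨ lemma₂ (2 ^ e) ⟩
    3 * (2 * 2 ^ e)           ∎)
  where
  open ≡-Reasoning
  lemma₁ : ∀ N → 2 + ((1 + N) + (1 + N)) + 2 ≡ 2 * ((1 + N) + 2)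
  lemma₁ = solve-∀
  lemma₂ : ∀ x → 2 * (3 * x) ≡ 3 * (2 * x)
  lemma₂ = solve-∀

-- The bounds on the maximum b(d) are stated as the existence of one large cover and a bound on all
-- covers; the 2 is moved across to avoid truncated subtraction.
theorem1p3 : (d : ℕ) → 1 ≤ d →
    (Σ[ m ∈ ℕ ] Σ[ n ∈ ℕ ] Σ[ H ∈ Family m n ]
    (MinimalEdgeCover m n H × HasDegree m n d H × 3 * 2 ^ (d ∸ 1) ≤ length H + 2))
    × ((m n : ℕ) (H : Family m n) → MinimalEdgeCover m n H → HasDegree m n d H →
    length H ≤ (d ∸ 1) * ((2 * d ∸ 1) C d) + 1)
theorem1p3 (suc e) _ = lower , upper
  where
  lower : Σ[ m ∈ ℕ ] Σ[ n ∈ ℕ ] Σ[ H ∈ Family m n ]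
    (MinimalEdgeCover m n H × HasDegree m n (suc e) H × 3 * 2 ^ e ≤ length H + 2)
  lower with N , m , P , eq ← lower-bound e
        with H , minimal , degree , ∣H∣≡N ← critical⇒minimal P =
    m , m , H , minimal , degree , ≤-reflexive (trans (sym eq) (cong (_+ 2) (sym ∣H∣≡N)))
  upper : (m n : ℕ) (H : Family m n) → MinimalEdgeCover m n H → HasDegree m n (suc e) H →
    length H ≤ e * ((2 * suc e ∸ 1) C suc e) + 1
  upper m n H minimal degree =
    -- `2 * suc e ∸ 1` computes to `e + (suc e + 0)`.
    subst (λ z → length H ≤ e * ((e + z) C suc e) + 1) (sym (+-identityʳ (suc e)))
      (upper-bound (minimal⇒critical m n minimal degree))
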